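{- Let $M$ be a matroid on $S$ and $N$ a matroid on $T$, with $S\cap T=\emptyset$, and let $L=M\mathbin{\Box} N$ be their free product, a matroid on $S+T$. Then for any $U\subseteq S+T$ such that $|U|=|S|$ and $\rho_L(U)=\rho(M)$, there exist bijective weak maps $L|U\to M$ and $L/U\to N$.
   Context: Matroids are on finite ground sets. For a matroid $M$ on $S$ with rank function $\rho_M$, write $\rho(M)=\rho_M(S)$, $\nu_M(A)=|A|-\rho_M(A)$ (nullity) and $\lambda_M(A)=\rho(M)-\rho_M(A)$ (rank-lack) for $A\subseteq S$. $S+T$ denotes the disjoint union. For matroids $M$ on $S$ and $N$ on $T$, with $S\cap T=\emptyset$, the free product $M\mathbin{\Box} N$ is the matroid on $S+T$ whose independent sets are exactly those $A\subseteq S+T$ such that $A\cap S$ is independent in $M$ and $\lambda_M(A\cap S)\geq \nu_N(A\cap T)$ (this family is indeed the family of independent sets of a matroid). $L|U$ denotes the restriction of $L$ to $U$, and $L/U$ denotes the matroid on $(S+T)\setminus U$ obtained from $L$ by contracting $U$. A bijective weak map $P\to Q$ between matroids is a bijection $\phi$ from the ground set of $P$ to the ground set of $Q$ such that $\phi^{ -1}(I)$ is independent in $P$ whenever $I$ is independent in $Q$. -}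

module Defs where

open import Data.Empty using (⊥-elim)
open import Data.Fin.Base using (Fin; zero; suc)
open import Data.Fin.Subset
open import Data.Fin.Subset.Properties
open import Data.List.Base as List using (List)
open import Data.List.Extrema.Nat using (max; argmax-sel; v≤max⁺)
open import Data.List.Membership.Propositional using (lose) renaming (_∈_ to _∈ˡ_)
open import Data.List.Membership.Propositional.Properties
  using (∈-map⁺; ∈-map⁻; ∈-filter⁺; ∈-filter⁻; ∈-++⁺ˡ; ∈-++⁺ʳ)
import Data.List.Relation.Unary.Any as Any
open import Data.Nat.Base hiding (_/_)
open import Data.Nat.Properties hiding (_≟_)
import Data.Nat.Properties as ℕ
open import Data.Product.Base using (Σ-syntax; ∃; _×_; _,_; proj₁; proj₂)
open import Data.Sum.Base using (inj₁; inj₂; [_,_])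
open import Data.Vec.Base using ([]; _∷_; here; there; tabulate)
open import Function.Base using (_∘_)
open import Function.Bundles using (_⤖_; Bijection)
open import Relation.Binary.PropositionalEquality
  using (_≡_; refl; sym; trans; cong; subst; subst₂)
open import Relation.Nullary using (¬_; Dec; yes; no; does; _×-dec_)
open import Relation.Nullary.Decidable using (map′)
open import Relation.Unary using (Decidable)

private
  variable
    k l : ℕ

------------------------------------------------------------------------
-- Finite sets

∪-lub : ∀ {A B C : Subset k} → A ⊆ C → B ⊆ C → A ∪ B ⊆ C
∪-lub {A = A} {B} A⊆C B⊆C x∈ = [ A⊆C , B⊆C ] (x∈p∪q⁻ A B x∈)

∪-monoˡ : ∀ {A B : Subset k} (C : Subset k) → A ⊆ B → A ∪ C ⊆ B ∪ C
∪-monoˡ {B = B} C A⊆B = ∪-lub (p⊆p∪q C ∘ A⊆B) (q⊆p∪q B C)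

∩-monoˡ : ∀ {A B : Subset k} (C : Subset k) → A ⊆ B → A ∩ C ⊆ B ∩ C
∩-monoˡ {A = A} C A⊆B x∈ with x∈p∩q⁻ A C x∈
... | x∈A , x∈C = x∈p∩q⁺ (A⊆B x∈A , x∈C)

⁅⁆⊆ : ∀ {x} {A : Subset k} → x ∈ A → ⁅ x ⁆ ⊆ A
⁅⁆⊆ {x = x} x∈A y∈ with x∈⁅y⁆⇒x≡y x y∈
... | refl = x∈A

∣∪∣+∣∩∣ : ∀ (A B : Subset k) → ∣ A ∪ B ∣ + ∣ A ∩ B ∣ ≡ ∣ A ∣ + ∣ B ∣
∣∪∣+∣∩∣ []            []            = refl
∣∪∣+∣∩∣ (inside  ∷ A) (inside  ∷ B) = cong suc (trans (+-suc ∣ A ∪ B ∣ ∣ A ∩ B ∣)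
  (trans (cong suc (∣∪∣+∣∩∣ A B)) (sym (+-suc ∣ A ∣ ∣ B ∣))))
∣∪∣+∣∩∣ (inside  ∷ A) (outside ∷ B) = cong suc (∣∪∣+∣∩∣ A B)
∣∪∣+∣∩∣ (outside ∷ A) (inside  ∷ B) =
  trans (cong suc (∣∪∣+∣∩∣ A B)) (sym (+-suc ∣ A ∣ ∣ B ∣))
∣∪∣+∣∩∣ (outside ∷ A) (outside ∷ B) = ∣∪∣+∣∩∣ A B

∣∪∣-disjoint : ∀ (A B : Subset k) → Empty (A ∩ B) → ∣ A ∪ B ∣ ≡ ∣ A ∣ + ∣ B ∣
∣∪∣-disjoint {k} A B A∩B=∅ = trans (sym (+-identityʳ ∣ A ∪ B ∣)) (trans
  (cong (∣ A ∪ B ∣ +_)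
    (sym (trans (cong ∣_∣ (Empty-unique A∩B=∅)) (∣⊥∣≡0 k))))
  (∣∪∣+∣∩∣ A B))

∣∪⁅⁆∣ : ∀ {x} (A : Subset k) → x ∉ A → ∣ A ∪ ⁅ x ⁆ ∣ ≡ suc ∣ A ∣
∣∪⁅⁆∣ {x = x} A x∉A = trans
  (∣∪∣-disjoint A ⁅ x ⁆ λ where
    (y , y∈) → let y∈A , y∈x = x∈p∩q⁻ A ⁅ x ⁆ y∈
               in x∉A (subst (_∈ A) (x∈⁅y⁆⇒x≡y x y∈x) y∈A))
  (trans (cong (∣ A ∣ +_) (∣⁅x⁆∣≡1 x)) (+-comm ∣ A ∣ 1))

∣split∣ : ∀ {S T : Subset k} → Empty (S ∩ T) → (A : Subset k) → A ⊆ S ∪ T →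
          ∣ A ∣ ≡ ∣ A ∩ S ∣ + ∣ A ∩ T ∣
∣split∣ {S = S} {T} S∩T=∅ A A⊆S∪T = trans (cong ∣_∣ A≡)
  (∣∪∣-disjoint (A ∩ S) (A ∩ T) λ where
    (x , x∈) → let x∈AS , x∈AT = x∈p∩q⁻ (A ∩ S) (A ∩ T) x∈
               in S∩T=∅ (x , x∈p∩q⁺ (p∩q⊆q A S x∈AS , p∩q⊆q A T x∈AT)))
  where
  A≡ : A ≡ (A ∩ S) ∪ (A ∩ T)
  A≡ = ⊆-antisym
    (λ x∈A → [ (λ x∈S → p⊆p∪q (A ∩ T) (x∈p∩q⁺ (x∈A , x∈S)))
             , (λ x∈T → q⊆p∪q (A ∩ S) (A ∩ T) (x∈p∩q⁺ (x∈A , x∈T))) ]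
             (x∈p∪q⁻ S T (A⊆S∪T x∈A)))
    (∪-lub (p∩q⊆p A S) (p∩q⊆p A T))

allSubsets : ∀ k → List (Subset k)
allSubsets zero    = List.[ [] ]
allSubsets (suc k) = List.map (outside ∷_) (allSubsets k)
               List.++ List.map (inside ∷_) (allSubsets k)

∈-allSubsets : (A : Subset k) → A ∈ˡ allSubsets k
∈-allSubsets []            = Any.here refl
∈-allSubsets (outside ∷ A) = ∈-++⁺ˡ (∈-map⁺ _ (∈-allSubsets A))
∈-allSubsets (inside  ∷ A) = ∈-++⁺ʳ (List.map (outside ∷_) _) (∈-map⁺ _ (∈-allSubsets A))

------------------------------------------------------------------------
-- Matroids

-- The ground set E is a subset of an ambient finite set Fin k, so that unions,
-- restrictions and contractions of ground sets are again ground sets.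
-- Independence is decidable because finite matroids are classical objects:
-- this is what makes the rank a computable number.
record Matroid {k : ℕ} (E : Subset k) : Set₁ where
  field
    Indep   : Subset k → Set
    indep?  : Decidable Indep
    indep⊆E : ∀ {A} → Indep A → A ⊆ E
    ⊥-indep : Indep ⊥
    ⊆-indep : ∀ {A B} → A ⊆ B → Indep B → Indep A
    augment : ∀ {A B} → Indep A → Indep B → ∣ A ∣ < ∣ B ∣ →
              ∃ λ x → x ∈ B × x ∉ A × Indep (A ∪ ⁅ x ⁆)

  indepSubsets : Subset k → List (Subset k)
  indepSubsets A = List.filter (λ I → I ⊆? A ×-dec indep? I) (allSubsets k)

  rank : Subset k → ℕ
  rank A = max 0 (List.map ∣_∣ (indepSubsets A))

  -- ρ(A) ≤ |A| and ρ(A) ≤ ρ(E), so neither subtraction truncates.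
  nullity : Subset k → ℕ
  nullity A = ∣ A ∣ ∸ rank A

  rankLack : Subset k → ℕ
  rankLack A = rank E ∸ rank A

  IsBasisOf : Subset k → Subset k → Set
  IsBasisOf B A = B ⊆ A × Indep B × ∣ B ∣ ≡ rank A

  isBasisOf? : ∀ B A → Dec (IsBasisOf B A)
  isBasisOf? B A = B ⊆? A ×-dec indep? B ×-dec ∣ B ∣ ℕ.≟ rank A

  ∣indep∣≤rank : ∀ {I A} → I ⊆ A → Indep I → ∣ I ∣ ≤ rank A
  ∣indep∣≤rank {I} {A} I⊆A i = v≤max⁺ 0 (List.map ∣_∣ (indepSubsets A))
    (inj₂ (lose (∈-map⁺ ∣_∣ I∈) ≤-refl))
    where
    I∈ : I ∈ˡ indepSubsets A
    I∈ = ∈-filter⁺ (λ I → I ⊆? A ×-dec indep? I) (∈-allSubsets I) (I⊆A , i)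

  basis : ∀ A → ∃ λ B → IsBasisOf B A
  basis A with argmax-sel (λ n → n) 0 (List.map ∣_∣ (indepSubsets A))
  ... | inj₁ rank≡0 = ⊥ , ⊥⊆ , ⊥-indep , trans (∣⊥∣≡0 k) (sym rank≡0)
  ... | inj₂ rank∈  with ∈-map⁻ ∣_∣ rank∈
  ...   | B , B∈ , rank≡ =
    let _ , B⊆A , b = ∈-filter⁻ (λ I → I ⊆? A ×-dec indep? I) {xs = allSubsets k} B∈
    in B , B⊆A , b , sym rank≡

  rank-mono : ∀ {A B} → A ⊆ B → rank A ≤ rank B
  rank-mono {A} A⊆B =
    let I , I⊆A , i , ∣I∣≡ = basis A
    in subst (_≤ rank _) ∣I∣≡ (∣indep∣≤rank (A⊆B ∘ I⊆A) i)

  rank-indep : ∀ {A} → Indep A → rank A ≡ ∣ A ∣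
  rank-indep {A} a =
    let _ , I⊆A , _ , ∣I∣≡ = basis A
    in ≤-antisym (subst (_≤ ∣ A ∣) ∣I∣≡ (p⊆q⇒∣p∣≤∣q∣ I⊆A)) (∣indep∣≤rank ⊆-refl a)

  nullity-mono : ∀ {A B} → A ⊆ B → nullity A ≤ nullity B
  nullity-mono {A} {B} A⊆B with basis B
  ... | J , J⊆B , j , ∣J∣≡ = m≤n+o⇒m∸n≤o ∣ A ∣ (rank A) (begin
    ∣ A ∣                                  ≡⟨ m+n∸m≡n (rank B) ∣ A ∣ ⟨
    rank B + ∣ A ∣ ∸ rank B                ≡⟨ cong (λ r → r + ∣ A ∣ ∸ rank B) ∣J∣≡ ⟨
    ∣ J ∣ + ∣ A ∣ ∸ rank B                 ≡⟨ cong (_∸ rank B) (∣∪∣+∣∩∣ J A) ⟨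
    ∣ J ∪ A ∣ + ∣ J ∩ A ∣ ∸ rank B         ≤⟨ ∸-monoˡ-≤ (rank B) (+-mono-≤
                                               (p⊆q⇒∣p∣≤∣q∣ (∪-lub J⊆B A⊆B))
                                               (∣indep∣≤rank (p∩q⊆q J A) (⊆-indep (p∩q⊆p J A) j))) ⟩
    ∣ B ∣ + rank A ∸ rank B                ≡⟨ cong (_∸ rank B) (+-comm ∣ B ∣ (rank A)) ⟩
    rank A + ∣ B ∣ ∸ rank B                ≡⟨ +-∸-assoc (rank A) rankB≤∣B∣ ⟩
    rank A + nullity B                     ∎)
    where
    open ≤-Reasoning
    rankB≤∣B∣ : rank B ≤ ∣ B ∣
    rankB≤∣B∣ = subst (_≤ ∣ B ∣) ∣J∣≡ (p⊆q⇒∣p∣≤∣q∣ J⊆B)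

  rank-augment : ∀ {A B} → rank A < rank B →
                 ∃ λ x → x ∈ B × x ∉ A × rank A < rank (A ∪ ⁅ x ⁆)
  rank-augment {A} {B} r<r =
    let I , I⊆A , i , ∣I∣≡ = basis A
        J , J⊆B , j , ∣J∣≡ = basis B
        x , x∈J , x∉I , ix = augment i j (subst₂ _<_ (sym ∣I∣≡) (sym ∣J∣≡) r<r)
        rA<∣Ix∣ : rank A < ∣ I ∪ ⁅ x ⁆ ∣
        rA<∣Ix∣ = ≤-reflexive (trans (cong suc (sym ∣I∣≡)) (sym (∣∪⁅⁆∣ I x∉I)))
    in x , J⊆B x∈J
     , (λ x∈A → <⇒≱ rA<∣Ix∣ (∣indep∣≤rank (∪-lub I⊆A (⁅⁆⊆ x∈A)) ix))
     , <-≤-trans rA<∣Ix∣ (∣indep∣≤rank (∪-monoˡ ⁅ x ⁆ I⊆A) ix)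

open Matroid public
  using (Indep; rank; nullity; rankLack; IsBasisOf)

------------------------------------------------------------------------
-- Restriction and contraction

infixl 7 _↾_ _/_

_↾_ : {E : Subset k} → Matroid E → (U : Subset k) → Matroid U
L ↾ U = record
  { Indep   = λ A → A ⊆ U × Indep L A
  ; indep?  = λ A → A ⊆? U ×-dec L.indep? A
  ; indep⊆E = proj₁
  ; ⊥-indep = ⊥⊆ , L.⊥-indep
  ; ⊆-indep = λ A⊆B (B⊆U , b) → B⊆U ∘ A⊆B , L.⊆-indep A⊆B b
  ; augment = λ (A⊆U , a) (B⊆U , b) ∣A∣<∣B∣ →
      let x , x∈B , x∉A , ax = L.augment a b ∣A∣<∣B∣
      in x , x∈B , x∉A , ∪-lub A⊆U (⁅⁆⊆ (B⊆U x∈B)) , ax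
  }
  where module L = Matroid L

-- A is independent in L / U iff A ∪ K is independent in L for a basis K of U;
-- the choice of K is immaterial.
_/_ : {E : Subset k} → Matroid E → (U : Subset k) → Matroid (E ─ U)
_/_ {k} {E} L U = record
  { Indep   = Indep/
  ; indep?  = λ A → A ⊆? (E ─ U) ×-dec
                    anySubset? (λ K → L.isBasisOf? K U ×-dec L.indep? (A ∪ K))
  ; indep⊆E = proj₁
  ; ⊥-indep = let K , K-basis@(_ , i , _) = L.basis U
              in ⊥⊆ , K , K-basis , L.⊆-indep (∪-lub ⊥⊆ ⊆-refl) i
  ; ⊆-indep = λ A⊆B (B⊆ , K , K-basis , bk) →
      B⊆ ∘ A⊆B , K , K-basis , L.⊆-indep (∪-monoˡ K A⊆B) bk
  ; augment = augment/
  }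
  where
  module L = Matroid L

  Indep/ : Subset k → Set
  Indep/ A = A ⊆ E ─ U × ∃ λ K → IsBasisOf L K U × Indep L (A ∪ K)

  ∉U : ∀ {x} → x ∈ E ─ U → x ∉ U
  ∉U {x} x∈ x∈U = go x E U x∈ x∈U
    where
    go : ∀ {n} (x : Fin n) (P Q : Subset n) → x ∈ P ─ Q → ¬ (x ∈ Q)
    go (suc x) (_ ∷ P) (_ ∷ Q) (there x∈) (there x∈Q) = go x P Q x∈ x∈Q
    go zero    (_ ∷ P) (inside ∷ Q) () here

  ∣∪basis∣ : ∀ {A K} → A ⊆ E ─ U → IsBasisOf L K U → ∣ A ∪ K ∣ ≡ ∣ A ∣ + rank L U
  ∣∪basis∣ {A} {K} A⊆ (K⊆U , _ , ∣K∣≡) = trans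
    (∣∪∣-disjoint A K λ where
      (x , x∈) → let x∈A , x∈K = x∈p∩q⁻ A K x∈ in ∉U (A⊆ x∈A) (K⊆U x∈K))
    (cong (∣ A ∣ +_) ∣K∣≡)

  augment/ : ∀ {A B} → Indep/ A → Indep/ B → ∣ A ∣ < ∣ B ∣ →
             ∃ λ x → x ∈ B × x ∉ A × Indep/ (A ∪ ⁅ x ⁆)
  augment/ {A} {B} (A⊆ , K , K-basis@(K⊆U , _ , ∣K∣≡) , ak)
                   (B⊆ , J , J-basis@(J⊆U , _) , bj) ∣A∣<∣B∣
    with L.augment ak bj (subst₂ _<_ (sym (∣∪basis∣ A⊆ K-basis))
                                     (sym (∣∪basis∣ B⊆ J-basis))
                                     (+-monoˡ-< (rank L U) ∣A∣<∣B∣))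
  ... | x , x∈BJ , x∉AK , akx with x∈p∪q⁻ B J x∈BJ
  ...   | inj₁ x∈B = x , x∈B , x∉AK ∘ p⊆p∪q K
                   , ∪-lub A⊆ (⁅⁆⊆ (B⊆ x∈B)) , K , K-basis
                   , L.⊆-indep (∪-lub (∪-monoˡ ⁅ x ⁆ (p⊆p∪q K))
                                      (p⊆p∪q ⁅ x ⁆ ∘ q⊆p∪q A K)) akx
  ...   | inj₂ x∈J = ⊥-elim (<⇒≱ rU<∣Kx∣
                       (L.∣indep∣≤rank (∪-lub K⊆U (⁅⁆⊆ (J⊆U x∈J)))
                         (L.⊆-indep (∪-monoˡ ⁅ x ⁆ (q⊆p∪q A K)) akx)))
    where
    rU<∣Kx∣ : rank L U < ∣ K ∪ ⁅ x ⁆ ∣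
    rU<∣Kx∣ = ≤-reflexive (trans (cong suc (sym ∣K∣≡))
                                 (sym (∣∪⁅⁆∣ K (x∉AK ∘ q⊆p∪q A K))))

------------------------------------------------------------------------
-- Free product

freeProduct : {S T : Subset k} → Matroid S → Matroid T → Empty (S ∩ T) → Matroid (S ∪ T)
freeProduct {k} {S} {T} M N S∩T=∅ = record
  { Indep   = Indep□
  ; indep?  = λ A → A ⊆? (S ∪ T) ×-dec M.indep? (A ∩ S) ×-dec
                    nullity N (A ∩ T) ≤? rankLack M (A ∩ S)
  ; indep⊆E = proj₁
  ; ⊥-indep = from-size ⊥⊆ (M.⊆-indep (p∩q⊆p ⊥ S) M.⊥-indep)
                (subst (_≤ rank M S + rank N (⊥ ∩ T)) (sym (∣⊥∣≡0 k)) z≤n)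
  ; ⊆-indep = ⊆-indep□
  ; augment = augment□
  }
  where
  module M = Matroid M
  module N = Matroid N

  Indep□ : Subset k → Set
  Indep□ A = A ⊆ S ∪ T × Indep M (A ∩ S) × rankLack M (A ∩ S) ≥ nullity N (A ∩ T)

  bound : Subset k → ℕ
  bound A = rank M S + rank N (A ∩ T)

  from-size : ∀ {A} → A ⊆ S ∪ T → Indep M (A ∩ S) → ∣ A ∣ ≤ bound A → Indep□ A
  from-size {A} A⊆ a ∣A∣≤ = A⊆ , a , m≤n+o⇒m∸n≤o ∣ A ∩ T ∣ (rank N (A ∩ T)) (begin
    ∣ A ∩ T ∣                                     ≡⟨ m+n∸m≡n ∣ A ∩ S ∣ ∣ A ∩ T ∣ ⟨
    ∣ A ∩ S ∣ + ∣ A ∩ T ∣ ∸ ∣ A ∩ S ∣             ≡⟨ cong (_∸ ∣ A ∩ S ∣) (∣split∣ S∩T=∅ A A⊆) ⟨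
    ∣ A ∣ ∸ ∣ A ∩ S ∣                             ≤⟨ ∸-monoˡ-≤ ∣ A ∩ S ∣ ∣A∣≤ ⟩
    rank M S + rank N (A ∩ T) ∸ ∣ A ∩ S ∣         ≡⟨ cong (_∸ ∣ A ∩ S ∣) (+-comm (rank M S) _) ⟩
    rank N (A ∩ T) + rank M S ∸ ∣ A ∩ S ∣         ≡⟨ +-∸-assoc (rank N (A ∩ T)) (M.∣indep∣≤rank (p∩q⊆q A S) a) ⟩
    rank N (A ∩ T) + (rank M S ∸ ∣ A ∩ S ∣)       ≡⟨ cong (λ r → rank N (A ∩ T) + (rank M S ∸ r)) (M.rank-indep a) ⟨
    rank N (A ∩ T) + rankLack M (A ∩ S)           ∎)
    where open ≤-Reasoning

  to-size : ∀ {A} → Indep□ A → ∣ A ∣ ≤ bound A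
  to-size {A} (A⊆ , a , ν≤λ) = begin
    ∣ A ∣                                                     ≡⟨ ∣split∣ S∩T=∅ A A⊆ ⟩
    ∣ A ∩ S ∣ + ∣ A ∩ T ∣                                     ≤⟨ +-monoʳ-≤ ∣ A ∩ S ∣ (m∸n≤o⇒m≤n+o′ ν≤λ) ⟩
    ∣ A ∩ S ∣ + (rankLack M (A ∩ S) + rank N (A ∩ T))         ≡⟨ +-assoc ∣ A ∩ S ∣ _ _ ⟨
    ∣ A ∩ S ∣ + rankLack M (A ∩ S) + rank N (A ∩ T)           ≡⟨ cong (λ r → ∣ A ∩ S ∣ + (rank M S ∸ r) + rank N (A ∩ T)) (M.rank-indep a) ⟩
    ∣ A ∩ S ∣ + (rank M S ∸ ∣ A ∩ S ∣) + rank N (A ∩ T)       ≡⟨ cong (_+ rank N (A ∩ T)) (m+[n∸m]≡n (M.∣indep∣≤rank (p∩q⊆q A S) a)) ⟩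
    rank M S + rank N (A ∩ T)                                 ∎
    where
    open ≤-Reasoning
    m∸n≤o⇒m≤n+o′ : ∀ {m n o} → m ∸ n ≤ o → m ≤ o + n
    m∸n≤o⇒m≤n+o′ {m} {n} {o} m∸n≤o = ≤-trans (m≤n+m∸n m n)
      (≤-trans (+-monoʳ-≤ n m∸n≤o) (≤-reflexive (+-comm n o)))

  ⊆-indep□ : ∀ {A B} → A ⊆ B → Indep□ B → Indep□ A
  ⊆-indep□ {A} {B} A⊆B (B⊆ , b , ν≤λ) =
      B⊆ ∘ A⊆B
    , M.⊆-indep (∩-monoˡ S A⊆B) b
    , ≤-trans (N.nullity-mono (∩-monoˡ T A⊆B))
        (≤-trans ν≤λ (∸-monoʳ-≤ (rank M S) (M.rank-mono (∩-monoˡ S A⊆B))))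

  extend : ∀ {A B} → Indep□ A → Indep□ B → ∀ x → x ∈ B → x ∉ A →
           Indep M ((A ∪ ⁅ x ⁆) ∩ S) → ∣ A ∣ < bound (A ∪ ⁅ x ⁆) →
           ∃ λ x → x ∈ B × x ∉ A × Indep□ (A ∪ ⁅ x ⁆)
  extend {A} (A⊆ , _) (B⊆ , _) x x∈B x∉A ax ∣A∣< = x , x∈B , x∉A ,
    from-size (∪-lub A⊆ (⁅⁆⊆ (B⊆ x∈B))) ax (subst (_≤ bound (A ∪ ⁅ x ⁆)) (sym (∣∪⁅⁆∣ A x∉A)) ∣A∣<)

  bound-mono : ∀ {A B} → A ⊆ B → bound A ≤ bound B
  bound-mono A⊆B = +-monoʳ-≤ (rank M S) (N.rank-mono (∩-monoˡ T A⊆B))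

  ∪⁅⁆∩⊆ : ∀ {A x} → (A ∪ ⁅ x ⁆) ∩ S ⊆ (A ∩ S) ∪ ⁅ x ⁆
  ∪⁅⁆∩⊆ {A} {x} y∈ with x∈p∩q⁻ (A ∪ ⁅ x ⁆) S y∈
  ... | y∈Ax , y∈S = [ (λ y∈A → p⊆p∪q ⁅ x ⁆ (x∈p∩q⁺ (y∈A , y∈S)))
                     , q⊆p∪q (A ∩ S) ⁅ x ⁆ ] (x∈p∪q⁻ A ⁅ x ⁆ y∈Ax)

  ∪⁅T⁆∩⊆ : ∀ {A x} → x ∈ T → (A ∪ ⁅ x ⁆) ∩ S ⊆ A ∩ S
  ∪⁅T⁆∩⊆ {A} {x} x∈T y∈ with x∈p∩q⁻ (A ∪ ⁅ x ⁆) S y∈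
  ... | y∈Ax , y∈S = x∈p∩q⁺
    ( [ (λ y∈A → y∈A) , (λ y∈x → ⊥-elim (S∩T=∅ (_ , x∈p∩q⁺ (y∈S , ⁅⁆⊆ x∈T y∈x)))) ]
      (x∈p∪q⁻ A ⁅ x ⁆ y∈Ax)
    , y∈S )

  augment□ : ∀ {A B} → Indep□ A → Indep□ B → ∣ A ∣ < ∣ B ∣ →
             ∃ λ x → x ∈ B × x ∉ A × Indep□ (A ∪ ⁅ x ⁆)
  augment□ {A} {B} ia@(A⊆ , a , _) ib@(B⊆ , b , _) ∣A∣<∣B∣ with ∣ A ∣ <? bound A
  ... | no ∣A∣≮ =
    let rank< : rank N (A ∩ T) < rank N (B ∩ T)
        rank< = +-cancelˡ-< (rank M S) _ _
                  (≤-<-trans (≮⇒≥ ∣A∣≮) (<-≤-trans ∣A∣<∣B∣ (to-size ib)))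
        x , x∈BT , x∉AT , r< = N.rank-augment rank<
        x∈B , x∈T = x∈p∩q⁻ B T x∈BT
        AT∪x⊆ : (A ∩ T) ∪ ⁅ x ⁆ ⊆ (A ∪ ⁅ x ⁆) ∩ T
        AT∪x⊆ = ∪-lub (∩-monoˡ T (p⊆p∪q ⁅ x ⁆))
                      (λ y∈x → x∈p∩q⁺ (q⊆p∪q A ⁅ x ⁆ y∈x , ⁅⁆⊆ x∈T y∈x))
    in extend ia ib x x∈B (λ x∈A → x∉AT (x∈p∩q⁺ (x∈A , x∈T)))
         (M.⊆-indep (∪⁅T⁆∩⊆ x∈T) a)
         (≤-<-trans (to-size ia)
           (+-monoʳ-< (rank M S) (<-≤-trans r< (N.rank-mono AT∪x⊆))))
  ... | yes ∣A∣< with nonempty? ((B ∩ T) ∩ ∁ A)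
  ...   | yes (x , x∈) =
    let x∈BT , x∈∁A = x∈p∩q⁻ (B ∩ T) (∁ A) x∈
        x∈B , x∈T = x∈p∩q⁻ B T x∈BT
    in extend ia ib x x∈B (x∈∁p⇒x∉p x∈∁A) (M.⊆-indep (∪⁅T⁆∩⊆ x∈T) a)
         (<-≤-trans ∣A∣< (bound-mono (p⊆p∪q ⁅ x ⁆)))
  ...   | no BT─A=∅ =
    let BT⊆AT : B ∩ T ⊆ A ∩ T
        BT⊆AT x∈BT = x∈p∩q⁺
          ( x∉∁p⇒x∈p (λ x∈∁A → BT─A=∅ (_ , x∈p∩q⁺ (x∈BT , x∈∁A)))
          , p∩q⊆q B T x∈BT )
        ∣AS∣<∣BS∣ : ∣ A ∩ S ∣ < ∣ B ∩ S ∣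
        ∣AS∣<∣BS∣ = +-cancelʳ-< ∣ A ∩ T ∣ _ _ (<-≤-trans
          (subst₂ _<_ (∣split∣ S∩T=∅ A A⊆) (∣split∣ S∩T=∅ B B⊆) ∣A∣<∣B∣)
          (+-monoʳ-≤ ∣ B ∩ S ∣ (p⊆q⇒∣p∣≤∣q∣ BT⊆AT)))
        x , x∈BS , x∉AS , asx = M.augment a b ∣AS∣<∣BS∣
        x∈B , x∈S = x∈p∩q⁻ B S x∈BS
    in extend ia ib x x∈B (λ x∈A → x∉AS (x∈p∩q⁺ (x∈A , x∈S)))
         (M.⊆-indep ∪⁅⁆∩⊆ asx)
         (<-≤-trans ∣A∣< (bound-mono (p⊆p∪q ⁅ x ⁆)))

------------------------------------------------------------------------
-- Weak maps

⟨_⟩ : Subset k → Set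
⟨ E ⟩ = ∃ λ x → x ∈ E

∈-irrelevant : ∀ {x} {A : Subset k} (p q : x ∈ A) → p ≡ q
∈-irrelevant here      here      = refl
∈-irrelevant (there p) (there q) = cong there (∈-irrelevant p q)

module _ {E : Subset k} {F : Subset l} (f : ⟨ E ⟩ → ⟨ F ⟩) (A : Subset l) where

  MapsInto : Fin k → Set
  MapsInto x = Σ[ x∈E ∈ x ∈ E ] proj₁ (f (x , x∈E)) ∈ A

  mapsInto? : Decidable MapsInto
  mapsInto? x with x ∈? E
  ... | no  x∉E = no (x∉E ∘ proj₁)
  ... | yes x∈E = map′ (x∈E ,_)
    (λ (x∈E′ , fx∈A) → subst (λ p → proj₁ (f (x , p)) ∈ A) (∈-irrelevant x∈E′ x∈E) fx∈A)
    (proj₁ (f (x , x∈E)) ∈? A)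

  -- f⁻¹(A), as a subset of the ambient Fin k contained in E.
  preimage : Subset k
  preimage = tabulate (does ∘ mapsInto?)

record BijectiveWeakMap {E : Subset k} {F : Subset l} (P : Matroid E) (Q : Matroid F) : Set where
  field
    φ              : ⟨ E ⟩ ⤖ ⟨ F ⟩
    preimage-indep : ∀ {I} → Indep Q I → Indep P (preimage (Bijection.to φ) I)

-- Both weak maps are bijections fixing every common element of the two ground sets; such a bijection
-- exists between any two finite sets of the same size.  Independence in L = M □ N reads
-- |A| ≤ ρ(M) + ρ_N(A ∩ T) once A ∩ S is independent in M, so for L|U → M it is enough that the
-- preimage P of an independent set is no larger than ρ(M).  For L/U → N let K be any basis of U in
-- L, so |K| = ρ(M); P ∪ K is independent in L when (P ∪ K) ∩ S is independent in M and P ∪ K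
-- contains the given independent set I of N.  If ρ_N(U ∩ T) = 0 then I misses U, whence P = I.
-- Otherwise K could be enlarged inside U unless U ∩ T ⊆ K and K ∩ S is a basis of U ∩ S; comparing
-- sizes, the elements of S ─ U, to which P ∩ S belongs, are then coloops of M.
module Submission where

open import Data.Empty using (⊥-elim)
open import Data.Fin.Base using (Fin; zero; suc)
open import Data.Fin.Properties using (injective⇒≤)
open import Data.Fin.Subset
  using (Subset; inside; outside; _∈_; _∉_; _∪_; _∩_; _⊆_; _─_; ∣_∣; Empty; ⁅_⁆)
open import Data.Fin.Subset.Properties
open import Data.Nat.Base using (ℕ; zero; suc; _+_; _≤_; _<_; z≤n; s≤s)
open import Data.Nat.Properties
open import Data.Product.Base using (Σ-syntax; ∃; _×_; _,_; proj₁; proj₂)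
open import Data.Sum.Base using (_⊎_; inj₁; inj₂; [_,_])
open import Data.Vec.Base using ([]; _∷_; here; there)
open import Data.Vec.Properties using ([]=⇒lookup; lookup⇒[]=; lookup∘tabulate)
open import Function.Base using (_∘_)
open import Function.Bundles using (_⤖_; _↔_; Bijection; Inverse; mk↔ₛ′)
open import Function.Construct.Composition using (_↔-∘_)
open import Function.Construct.Symmetry using (↔-sym)
open import Function.Definitions using (Injective)
open import Function.Properties.Inverse using (↔⇒⤖)
open import Relation.Binary.PropositionalEquality
  using (_≡_; refl; sym; trans; cong; subst; module ≡-Reasoning)
open import Relation.Nullary using (yes; no)
open import Relation.Nullary.Decidable using (dec-true; decidable-stable)
open import Defs

private
  variable
    k : ℕ

-- Differences and sizes of subsets.

x∈p─q⇒x∉q : ∀ {x} (p q : Subset k) → x ∈ p ─ q → x ∉ q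
x∈p─q⇒x∉q (_ ∷ p) (inside ∷ q) ()         here
x∈p─q⇒x∉q (_ ∷ p) (_      ∷ q) (there x∈) (there x∈q) = x∈p─q⇒x∉q p q x∈ x∈q

∣∩∣+∣─∣ : ∀ (p q : Subset k) → ∣ p ∣ ≡ ∣ p ∩ q ∣ + ∣ p ─ q ∣
∣∩∣+∣─∣ []            []            = refl
∣∩∣+∣─∣ (inside  ∷ p) (inside  ∷ q) = cong suc (∣∩∣+∣─∣ p q)
∣∩∣+∣─∣ (inside  ∷ p) (outside ∷ q) =
  trans (cong suc (∣∩∣+∣─∣ p q)) (sym (+-suc ∣ p ∩ q ∣ ∣ p ─ q ∣))
∣∩∣+∣─∣ (outside ∷ p) (inside  ∷ q) = ∣∩∣+∣─∣ p q
∣∩∣+∣─∣ (outside ∷ p) (outside ∷ q) = ∣∩∣+∣─∣ p q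

⊆∧∣≥∣⇒⊇ : ∀ {p q : Subset k} → p ⊆ q → ∣ q ∣ ≤ ∣ p ∣ → q ⊆ p
⊆∧∣≥∣⇒⊇ {p = p} p⊆q ∣q∣≤∣p∣ {x} x∈q = decidable-stable (x ∈? p) λ x∉p →
  <⇒≱ (p⊂q⇒∣p∣<∣q∣ (p⊆q , x , x∈q , x∉p)) ∣q∣≤∣p∣

-- Subsets enumerated by `Fin`, and bijections between them.

⟨⟩-≡ : ∀ {A : Subset k} {p q : ⟨ A ⟩} → proj₁ p ≡ proj₁ q → p ≡ q
⟨⟩-≡ {p = x , x∈} {q = .x , x∈′} refl = cong (x ,_) (∈-irrelevant x∈ x∈′)

index : ∀ (A : Subset k) → ⟨ A ⟩ → Fin ∣ A ∣
index (inside  ∷ A) (zero  , here)     = zero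
index (inside  ∷ A) (suc x , there x∈) = suc (index A (x , x∈))
index (outside ∷ A) (suc x , there x∈) = index A (x , x∈)

element : ∀ (A : Subset k) → Fin ∣ A ∣ → ⟨ A ⟩
element (inside  ∷ A) zero    = zero , here
element (inside  ∷ A) (suc i) = let x , x∈ = element A i in suc x , there x∈
element (outside ∷ A) i       = let x , x∈ = element A i in suc x , there x∈

index-element : ∀ (A : Subset k) i → index A (element A i) ≡ i
index-element (inside  ∷ A) zero    = refl
index-element (inside  ∷ A) (suc i) = cong suc (index-element A i)
index-element (outside ∷ A) i       = index-element A i

element-index : ∀ (A : Subset k) p → element A (index A p) ≡ p
element-index (inside  ∷ A) (zero  , here)     = refl
element-index (inside  ∷ A) (suc x , there x∈) =
  ⟨⟩-≡ (cong (suc ∘ proj₁) (element-index A (x , x∈)))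
element-index (outside ∷ A) (suc x , there x∈) =
  ⟨⟩-≡ (cong (suc ∘ proj₁) (element-index A (x , x∈)))

⟨⟩↔Fin : ∀ (A : Subset k) → ⟨ A ⟩ ↔ Fin ∣ A ∣
⟨⟩↔Fin A = mk↔ₛ′ (index A) (element A) (index-element A) (element-index A)

⟨⟩-injective⇒≤ : ∀ {A B : Subset k} {f : ⟨ A ⟩ → ⟨ B ⟩} → Injective _≡_ _≡_ f → ∣ A ∣ ≤ ∣ B ∣
⟨⟩-injective⇒≤ {A = A} {B} {f} f-inj = injective⇒≤ {f = index B ∘ f ∘ element A} λ {i} {j} eq →
  trans (sym (index-element A i)) (trans (cong (index A) (f-inj (
    trans (sym (element-index B _)) (trans (cong (element B) eq) (element-index B _)))))
  (index-element A j))

∣∣≡⇒⟨⟩↔ : ∀ {A B : Subset k} → ∣ A ∣ ≡ ∣ B ∣ → ⟨ A ⟩ ↔ ⟨ B ⟩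
∣∣≡⇒⟨⟩↔ {A = A} {B} eq = ↔-sym (⟨⟩↔Fin B) ↔-∘ subst (λ n → ⟨ A ⟩ ↔ Fin n) eq (⟨⟩↔Fin A)

-- Bijections that fix the common elements.

module _ {E F : Subset k} (g : ⟨ E ─ F ⟩ → ⟨ F ─ E ⟩) where

  extendById : ⟨ E ⟩ → ⟨ F ⟩
  extendById (x , x∈E) with x ∈? F
  ... | yes x∈F = x , x∈F
  ... | no  x∉F = let y , y∈ = g (x , x∈p∧x∉q⇒x∈p─q x∈E x∉F) in y , p─q⊆p F E y∈

  extendById-fixes : ∀ {x} (x∈E : x ∈ E) → x ∈ F → proj₁ (extendById (x , x∈E)) ≡ x
  extendById-fixes {x} x∈E x∈F with x ∈? F
  ... | yes _   = refl
  ... | no  x∉F = ⊥-elim (x∉F x∈F)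

  extendById-extends : ∀ {x} (x∈E : x ∈ E) (x∈ : x ∈ E ─ F) →
                       proj₁ (extendById (x , x∈E)) ≡ proj₁ (g (x , x∈))
  extendById-extends {x} x∈E x∈ with x ∈? F
  ... | yes x∈F = ⊥-elim (x∈p─q⇒x∉q E F x∈ x∈F)
  ... | no  x∉F = cong (proj₁ ∘ g) (⟨⟩-≡ refl)

extendById-inverse : ∀ {E F : Subset k} {g : ⟨ E ─ F ⟩ → ⟨ F ─ E ⟩} {h : ⟨ F ─ E ⟩ → ⟨ E ─ F ⟩} →
                     (∀ p → h (g p) ≡ p) → ∀ p → extendById h (extendById g p) ≡ p
extendById-inverse {E = E} {F} {g} {h} h∘g (x , x∈E) with x ∈? F
... | yes x∈F = ⟨⟩-≡ (extendById-fixes h x∈F x∈E)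
... | no  x∉F =
  let x∈     = x∈p∧x∉q⇒x∈p─q x∈E x∉F
      y , y∈ = g (x , x∈)
  in ⟨⟩-≡ (trans (extendById-extends h (p─q⊆p F E y∈) y∈) (cong proj₁ (h∘g (x , x∈))))

∣─∣-sym : ∀ {E F : Subset k} → ∣ E ∣ ≡ ∣ F ∣ → ∣ E ─ F ∣ ≡ ∣ F ─ E ∣
∣─∣-sym {E = E} {F} eq = +-cancelˡ-≡ ∣ E ∩ F ∣ _ _ (trans (sym (∣∩∣+∣─∣ E F)) (trans eq
  (trans (∣∩∣+∣─∣ F E) (cong (λ A → ∣ A ∣ + ∣ F ─ E ∣) (∩-comm F E)))))

-- Removing `E ∩ F` from both sides leaves `E ─ F` and `F ─ E` of equal size; a bijection between
-- these is extended by the identity. Fixing common elements makes a preimage comparable with the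
-- set it comes from.
fixingBijection : ∀ {E F : Subset k} → ∣ E ∣ ≡ ∣ F ∣ →
                  Σ[ φ ∈ ⟨ E ⟩ ⤖ ⟨ F ⟩ ]
                    (∀ {x} (x∈E : x ∈ E) → x ∈ F → proj₁ (Bijection.to φ (x , x∈E)) ≡ x)
fixingBijection {E = E} {F} eq =
    ↔⇒⤖ (mk↔ₛ′ (extendById to) (extendById from)
                (extendById-inverse strictlyInverseˡ) (extendById-inverse strictlyInverseʳ))
  , extendById-fixes to
  where open Inverse (∣∣≡⇒⟨⟩↔ {A = E ─ F} {F ─ E} (∣─∣-sym {E = E} {F} eq))

-- Preimages of subsets.

module _ {E F : Subset k} (f : ⟨ E ⟩ → ⟨ F ⟩) (A : Subset k) where

  ∈-preimage⁺ : ∀ {x} → MapsInto f A x → x ∈ preimage f A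
  ∈-preimage⁺ {x} fx∈A = lookup⇒[]= x _
    (trans (lookup∘tabulate _ x) (dec-true (mapsInto? f A x) fx∈A))

  ∈-preimage⁻ : ∀ {x} → x ∈ preimage f A → MapsInto f A x
  ∈-preimage⁻ {x} x∈ with mapsInto? f A x | trans (sym (lookup∘tabulate _ x)) ([]=⇒lookup x∈)
  ... | yes fx∈A | _  = fx∈A
  ... | no  _    | ()

  preimage⊆ : preimage f A ⊆ E
  preimage⊆ = proj₁ ∘ ∈-preimage⁻

  ∣preimage∣≤ : Injective _≡_ _≡_ f → ∣ preimage f A ∣ ≤ ∣ A ∣
  ∣preimage∣≤ f-inj = ⟨⟩-injective⇒≤
    {f = λ (x , x∈) → let x∈E , fx∈A = ∈-preimage⁻ x∈ in proj₁ (f (x , x∈E)) , fx∈A}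
    λ eq → ⟨⟩-≡ (cong proj₁ (f-inj (⟨⟩-≡ (cong proj₁ eq))))

  module _ (fixes : ∀ {x} (x∈E : x ∈ E) → x ∈ F → proj₁ (f (x , x∈E)) ≡ x) where

    preimage∩⊆ : preimage f A ∩ F ⊆ A
    preimage∩⊆ x∈ =
      let x∈P , x∈F  = x∈p∩q⁻ (preimage f A) F x∈
          x∈E , fx∈A = ∈-preimage⁻ x∈P
      in subst (_∈ A) (fixes x∈E x∈F) fx∈A

    ∩⊆preimage : A ⊆ F → A ∩ E ⊆ preimage f A
    ∩⊆preimage A⊆F x∈ =
      let x∈A , x∈E = x∈p∩q⁻ A E x∈
      in ∈-preimage⁺ (x∈E , subst (_∈ A) (sym (fixes x∈E (A⊆F x∈A))) x∈A)

-- Bases and coloops in a matroid.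

module _ {E : Subset k} (M : Matroid E) where

  private module M = Matroid M

  extendable⇒∣∣<rank : ∀ {I A x} → I ⊆ A → x ∈ A → x ∉ I → M.Indep (I ∪ ⁅ x ⁆) → ∣ I ∣ < M.rank A
  extendable⇒∣∣<rank {I} {A} I⊆A x∈A x∉I ix =
    subst (_≤ M.rank A) (∣∪⁅⁆∣ I x∉I) (M.∣indep∣≤rank (∪-lub I⊆A (⁅⁆⊆ x∈A)) ix)

  augment-in : ∀ {I A} → M.Indep I → ∣ I ∣ < M.rank A →
               ∃ λ x → x ∈ A × x ∉ I × M.Indep (I ∪ ⁅ x ⁆)
  augment-in {I} {A} i ∣I∣< =
    let B , B⊆A , b , ∣B∣≡ = M.basis A
        x , x∈B , x∉I , ix = M.augment i b (subst (∣ I ∣ <_) (sym ∣B∣≡) ∣I∣<)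
    in x , B⊆A x∈B , x∉I , ix

  extend-to-basis : ∀ {I A} → I ⊆ A → M.Indep I → ∃ λ J → I ⊆ J × M.IsBasisOf J A
  extend-to-basis {A = A} = go (M.rank A) (m≤m+n (M.rank A) _)
    where
    -- `n` bounds the number of elements still to be added; each augmentation uses up one.
    go : ∀ n {I} → M.rank A ≤ n + ∣ I ∣ → I ⊆ A → M.Indep I → ∃ λ J → I ⊆ J × M.IsBasisOf J A
    go n {I} rank≤ I⊆A i with m≤n⇒m<n∨m≡n (M.∣indep∣≤rank I⊆A i)
    ... | inj₂ ∣I∣≡ = I , ⊆-refl , I⊆A , i , ∣I∣≡
    go zero    rank≤ I⊆A i | inj₁ ∣I∣< = ⊥-elim (<⇒≱ ∣I∣< rank≤)
    go (suc n) {I} rank≤ I⊆A i | inj₁ ∣I∣< =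
      let x , x∈A , x∉I , ix = augment-in i ∣I∣<
          rank≤′ = subst (M.rank A ≤_) (trans (sym (+-suc n ∣ I ∣)) (cong (n +_) (sym (∣∪⁅⁆∣ I x∉I)))) rank≤
          J , Ix⊆J , J-basis = go n rank≤′ (∪-lub I⊆A (⁅⁆⊆ x∈A)) ix
      in J , Ix⊆J ∘ p⊆p∪q ⁅ x ⁆ , J-basis

  -- A rank of E as large as rank A + ∣ C ∣ forces every basis of E to contain C.
  ∪-coloops-indep : ∀ {A C I} → E ⊆ A ∪ C → Empty (A ∩ C) → M.rank A + ∣ C ∣ ≤ M.rank E →
                    M.Indep I → M.Indep (I ∪ C)
  ∪-coloops-indep {A} {C} {I} E⊆A∪C A∩C=∅ rank≥ i =
    let J , I⊆J , J⊆E , j , ∣J∣≡ = extend-to-basis (M.indep⊆E i) i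
        -- At most `rank A` elements of the basis `J` lie in `A`, so at least `∣ C ∣` of them, hence
        -- all of `C`, come from `C`.
        ∣C∣≤ : ∣ C ∣ ≤ ∣ J ∩ C ∣
        ∣C∣≤ = +-cancelˡ-≤ (M.rank A) _ _ (begin
          M.rank A + ∣ C ∣      ≤⟨ rank≥ ⟩
          M.rank E              ≡⟨ ∣J∣≡ ⟨
          ∣ J ∣                 ≡⟨ ∣split∣ A∩C=∅ J (E⊆A∪C ∘ J⊆E) ⟩
          ∣ J ∩ A ∣ + ∣ J ∩ C ∣ ≤⟨ +-monoˡ-≤ ∣ J ∩ C ∣
                                    (M.∣indep∣≤rank (p∩q⊆q J A) (M.⊆-indep (p∩q⊆p J A) j)) ⟩
          M.rank A + ∣ J ∩ C ∣  ∎)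
    in M.⊆-indep (∪-lub I⊆J (p∩q⊆p J C ∘ ⊆∧∣≥∣⇒⊇ (p∩q⊆q J C) ∣C∣≤)) j
    where open ≤-Reasoning

-- Independence in the free product.

module FreeProduct {S T : Subset k} (M : Matroid S) (N : Matroid T) (S∩T=∅ : Empty (S ∩ T)) where

  private
    L = freeProduct M N S∩T=∅
    module M = Matroid M
    module N = Matroid N
    module L = Matroid L

  -- Adding `∣ A ∩ S ∣`, which is the rank of `A ∩ S`, to both sides of nullity ≤ rank-lack cancels
  -- the truncated subtraction on the right.
  indep-from-size : ∀ {A} → A ⊆ S ∪ T → M.Indep (A ∩ S) →
                    ∣ A ∣ ≤ M.rank S + N.rank (A ∩ T) → L.Indep A
  indep-from-size {A} A⊆ a ∣A∣≤ = A⊆ , a ,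
    m≤n+o⇒m∸n≤o ∣ A ∩ T ∣ (N.rank (A ∩ T)) (+-cancelˡ-≤ ∣ A ∩ S ∣ _ _ (begin
      ∣ A ∩ S ∣ + ∣ A ∩ T ∣                            ≡⟨ ∣split∣ S∩T=∅ A A⊆ ⟨
      ∣ A ∣                                            ≤⟨ ∣A∣≤ ⟩
      M.rank S + N.rank (A ∩ T)                        ≡⟨ +-comm (M.rank S) _ ⟩
      N.rank (A ∩ T) + M.rank S                        ≡⟨ cong (N.rank (A ∩ T) +_) (m+[n∸m]≡n (M.rank-mono (p∩q⊆q A S))) ⟨
      N.rank (A ∩ T) + (M.rank (A ∩ S) + λA)           ≡⟨ cong (λ r → N.rank (A ∩ T) + (r + λA)) (M.rank-indep a) ⟩
      N.rank (A ∩ T) + (∣ A ∩ S ∣ + λA)                ≡⟨ +-assoc (N.rank (A ∩ T)) ∣ A ∩ S ∣ λA ⟨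
      N.rank (A ∩ T) + ∣ A ∩ S ∣ + λA                  ≡⟨ cong (_+ λA) (+-comm (N.rank (A ∩ T)) ∣ A ∩ S ∣) ⟩
      ∣ A ∩ S ∣ + N.rank (A ∩ T) + λA                  ≡⟨ +-assoc ∣ A ∩ S ∣ (N.rank (A ∩ T)) λA ⟩
      ∣ A ∩ S ∣ + (N.rank (A ∩ T) + λA)                ∎))
    where
    open ≤-Reasoning
    λA = M.rankLack (A ∩ S)

  -- Size counts and the weak map from the restriction.

  module _ {U : Subset k} (U⊆ : U ⊆ S ∪ T) (∣U∣≡∣S∣ : ∣ U ∣ ≡ ∣ S ∣) where

    -- `S` and `U` have equal size and share `S ∩ U`; what remains of `U` lies in `T`. This count
    -- later identifies coloops of `M`.
    ∣S─U∣≡∣U∩T∣ : ∣ S ─ U ∣ ≡ ∣ U ∩ T ∣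
    ∣S─U∣≡∣U∩T∣ = +-cancelˡ-≡ ∣ S ∩ U ∣ _ _ (trans (sym (∣∩∣+∣─∣ S U)) (trans (sym ∣U∣≡∣S∣)
      (trans (∣split∣ S∩T=∅ U U⊆) (cong (λ A → ∣ A ∣ + ∣ U ∩ T ∣) (∩-comm U S)))))

    ∣S∪T─U∣≡∣T∣ : ∣ (S ∪ T) ─ U ∣ ≡ ∣ T ∣
    ∣S∪T─U∣≡∣T∣ = +-cancelˡ-≡ ∣ S ∣ _ _ (begin
      ∣ S ∣ + ∣ (S ∪ T) ─ U ∣             ≡⟨ cong (_+ ∣ (S ∪ T) ─ U ∣) ∣U∣≡∣S∣ ⟨
      ∣ U ∣ + ∣ (S ∪ T) ─ U ∣             ≡⟨ cong (λ A → ∣ A ∣ + ∣ (S ∪ T) ─ U ∣) (⊆-antisym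
                                              (p∩q⊆q (S ∪ T) U) (λ x∈U → x∈p∩q⁺ (U⊆ x∈U , x∈U))) ⟨
      ∣ (S ∪ T) ∩ U ∣ + ∣ (S ∪ T) ─ U ∣   ≡⟨ ∣∩∣+∣─∣ (S ∪ T) U ⟨
      ∣ S ∪ T ∣                           ≡⟨ ∣∪∣-disjoint S T S∩T=∅ ⟩
      ∣ S ∣ + ∣ T ∣                       ∎)
      where open ≡-Reasoning

    restriction-weakMap : BijectiveWeakMap (L ↾ U) M
    restriction-weakMap = record
      { φ              = φ
      ; preimage-indep = λ {I} i →
          let P   = preimage f I
              P⊆U = preimage⊆ f I
          -- Elements of `U ∩ S` are fixed, so `P ∩ S` lies in `I`; the size bound already holds
          -- without the rank in `N`.
          in P⊆U , indep-from-size (U⊆ ∘ P⊆U) (M.⊆-indep (preimage∩⊆ f I fixes) i)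
               (≤-trans (∣preimage∣≤ f I (Bijection.injective φ))
                 (≤-trans (M.∣indep∣≤rank (M.indep⊆E i) i) (m≤m+n (M.rank S) (N.rank (P ∩ T)))))
      }
      where
      φ     = proj₁ (fixingBijection {E = U} {S} ∣U∣≡∣S∣)
      fixes = proj₂ (fixingBijection {E = U} {S} ∣U∣≡∣S∣)
      f     = Bijection.to φ

    -- Bases of `U` and the weak map from the contraction.

    module _ (rankU≡ : L.rank U ≡ M.rank S) {K} (K-basis : L.IsBasisOf K U) where

      private
        K⊆U : K ⊆ U
        K⊆U = proj₁ K-basis

        ∣K∣≡ : ∣ K ∣ ≡ M.rank S
        ∣K∣≡ = trans (proj₂ (proj₂ K-basis)) rankU≡

        k-indep : M.Indep (K ∩ S)
        k-indep = proj₁ (proj₂ (proj₁ (proj₂ K-basis)))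

      -- A positive rank would cover the one element by which `K ∪ ⁅ x ⁆` exceeds `ρ(M)`, giving an
      -- independent subset of `U` larger than the basis `K`.
      basis-maximal : ∀ {x} → x ∈ U → x ∉ K → M.Indep ((K ∪ ⁅ x ⁆) ∩ S) →
                      N.rank ((K ∪ ⁅ x ⁆) ∩ T) ≡ 0
      basis-maximal {x} x∈U x∉K kx = n≤0⇒n≡0 (≮⇒≥ λ 0< →
        <-irrefl (proj₂ (proj₂ K-basis)) (extendable⇒∣∣<rank L K⊆U x∈U x∉K
          (indep-from-size (U⊆ ∘ ∪-lub K⊆U (⁅⁆⊆ x∈U)) kx (begin
            ∣ K ∪ ⁅ x ⁆ ∣                        ≡⟨ ∣∪⁅⁆∣ K x∉K ⟩
            suc ∣ K ∣                            ≡⟨ cong suc ∣K∣≡ ⟩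
            suc (M.rank S)                       ≡⟨ +-comm 1 (M.rank S) ⟩
            M.rank S + 1                         ≤⟨ +-monoʳ-≤ (M.rank S) 0< ⟩
            M.rank S + N.rank ((K ∪ ⁅ x ⁆) ∩ T)  ∎))))
        where open ≤-Reasoning

      module _ (rank>0 : 0 < N.rank (U ∩ T)) where

        -- An element of `U ∩ T` missed by `K` forces `K ∩ T` to have rank 0. Rank augmentation then
        -- finds a `y` in `U ∩ T` that raises this rank, against the maximality of `K`.
        U∩T⊆basis : U ∩ T ⊆ K
        U∩T⊆basis {x} x∈UT = decidable-stable (x ∈? K) λ x∉K →
          let rankKT≡0 = n≤0⇒n≡0 (≤-trans (N.rank-mono (∩-monoˡ T (p⊆p∪q {p = K} ⁅ x ⁆)))
                           (≤-reflexive (maximal x∈UT x∉K)))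
              y , y∈UT , y∉KT , rank< =
                N.rank-augment (subst (_< N.rank (U ∩ T)) (sym rankKT≡0) rank>0)
              y∈T = p∩q⊆q U T y∈UT
              KT∪y⊆ = ∪-lub (∩-monoˡ T (p⊆p∪q {p = K} ⁅ y ⁆))
                            (λ z∈y → x∈p∩q⁺ (q⊆p∪q K ⁅ y ⁆ z∈y , ⁅⁆⊆ y∈T z∈y))
          in n≮0 (<-≤-trans rank< (≤-trans (N.rank-mono KT∪y⊆)
               (≤-reflexive (maximal y∈UT (λ y∈K → y∉KT (x∈p∩q⁺ (y∈K , y∈T)))))))
          where
          -- Adding an element of `T` leaves the part in `S` unchanged.
          maximal : ∀ {y} → y ∈ U ∩ T → y ∉ K → N.rank ((K ∪ ⁅ y ⁆) ∩ T) ≡ 0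
          maximal {y} y∈UT y∉K =
            let y∈U , y∈T = x∈p∩q⁻ U T y∈UT
            in basis-maximal y∈U y∉K (M.⊆-indep
                 (λ z∈ → let z∈Ky , z∈S = x∈p∩q⁻ (K ∪ ⁅ y ⁆) S z∈ in
                   [ (λ z∈K → x∈p∩q⁺ (z∈K , z∈S))
                   , (λ z∈y → ⊥-elim (S∩T=∅ (_ , x∈p∩q⁺ (z∈S , ⁅⁆⊆ y∈T z∈y)))) ]
                   (x∈p∪q⁻ K ⁅ y ⁆ z∈Ky))
                 k-indep)

        -- Otherwise some `x` in `U ∩ S` extends `K ∩ S`, and maximality gives rank 0 to a set
        -- containing `U ∩ T`, whose rank is positive.
        rank-U∩S≤ : M.rank (U ∩ S) ≤ ∣ K ∩ S ∣
        rank-U∩S≤ = ≮⇒≥ λ ∣KS∣< →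
          let x , x∈US , x∉KS , ksx = augment-in M k-indep ∣KS∣<
              x∈U , x∈S = x∈p∩q⁻ U S x∈US
              rank≡0 = basis-maximal x∈U (λ x∈K → x∉KS (x∈p∩q⁺ (x∈K , x∈S))) (M.⊆-indep
                (λ z∈ → let z∈Kx , z∈S = x∈p∩q⁻ (K ∪ ⁅ x ⁆) S z∈ in
                  [ (λ z∈K → p⊆p∪q ⁅ x ⁆ (x∈p∩q⁺ (z∈K , z∈S))) , q⊆p∪q (K ∩ S) ⁅ x ⁆ ]
                  (x∈p∪q⁻ K ⁅ x ⁆ z∈Kx))
                ksx)
              UT⊆ : U ∩ T ⊆ (K ∪ ⁅ x ⁆) ∩ T
              UT⊆ z∈ = x∈p∩q⁺ (p⊆p∪q ⁅ x ⁆ (U∩T⊆basis z∈) , p∩q⊆q U T z∈)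
          in n≮0 (subst (0 <_) rank≡0 (<-≤-trans rank>0 (N.rank-mono UT⊆)))

        -- `K` consists of `K ∩ S` and all of `U ∩ T`, so `ρ(M)` is at least the rank of `U ∩ S`
        -- plus `∣ S ─ U ∣`: the elements of `S ─ U` are coloops.
        basis∪S─U-indep : M.Indep ((K ∩ S) ∪ (S ─ U))
        basis∪S─U-indep = ∪-coloops-indep M {A = U ∩ S} S⊆ disjoint rank≥ k-indep
          where
          S⊆ : S ⊆ (U ∩ S) ∪ (S ─ U)
          S⊆ {x} x∈S with x ∈? U
          ... | yes x∈U = p⊆p∪q (S ─ U) (x∈p∩q⁺ (x∈U , x∈S))
          ... | no  x∉U = q⊆p∪q (U ∩ S) (S ─ U) (x∈p∧x∉q⇒x∈p─q x∈S x∉U)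

          disjoint : Empty ((U ∩ S) ∩ (S ─ U))
          disjoint (x , x∈) =
            let x∈US , x∈S─U = x∈p∩q⁻ (U ∩ S) (S ─ U) x∈
            in x∈p─q⇒x∉q S U x∈S─U (p∩q⊆p U S x∈US)

          open ≤-Reasoning
          rank≥ : M.rank (U ∩ S) + ∣ S ─ U ∣ ≤ M.rank S
          rank≥ = begin
            M.rank (U ∩ S) + ∣ S ─ U ∣  ≡⟨ cong (M.rank (U ∩ S) +_) ∣S─U∣≡∣U∩T∣ ⟩
            M.rank (U ∩ S) + ∣ U ∩ T ∣  ≤⟨ +-mono-≤ rank-U∩S≤ (p⊆q⇒∣p∣≤∣q∣
                                             (λ z∈ → x∈p∩q⁺ (U∩T⊆basis z∈ , p∩q⊆q U T z∈))) ⟩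
            ∣ K ∩ S ∣ + ∣ K ∩ T ∣       ≡⟨ ∣split∣ S∩T=∅ K (U⊆ ∘ K⊆U) ⟨
            ∣ K ∣                       ≡⟨ ∣K∣≡ ⟩
            M.rank S                    ∎

      -- `P` stands for the preimage of `I`. `P ∪ K` has at most `ρ(M) + ∣ I ∣` elements, and it
      -- contains `I`, so its part in `T` has rank at least `∣ I ∣`.
      ∪basis-indep : ∀ {I P} → N.Indep I → P ⊆ (S ∪ T) ─ U → ∣ P ∣ ≤ ∣ I ∣ → I ─ U ⊆ P →
                     L.Indep (P ∪ K)
      ∪basis-indep {I} {P} i P⊆ ∣P∣≤ I─U⊆P =
        indep-from-size (∪-lub (p─q⊆p (S ∪ T) U ∘ P⊆) (U⊆ ∘ K⊆U)) S-part (begin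
          ∣ P ∪ K ∣                          ≤⟨ m≤m+n ∣ P ∪ K ∣ ∣ P ∩ K ∣ ⟩
          ∣ P ∪ K ∣ + ∣ P ∩ K ∣              ≡⟨ ∣∪∣+∣∩∣ P K ⟩
          ∣ P ∣ + ∣ K ∣                      ≡⟨ +-comm ∣ P ∣ ∣ K ∣ ⟩
          ∣ K ∣ + ∣ P ∣                      ≤⟨ +-mono-≤ (≤-reflexive ∣K∣≡) ∣P∣≤ ⟩
          M.rank S + ∣ I ∣                   ≤⟨ +-monoʳ-≤ (M.rank S) (N.∣indep∣≤rank
                                                 (λ x∈I → x∈p∩q⁺ (I⊆P∪K x∈I , N.indep⊆E i x∈I)) i) ⟩
          M.rank S + N.rank ((P ∪ K) ∩ T)    ∎)
        where
        open ≤-Reasoning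

        I∩U⊆U∩T : I ∩ U ⊆ U ∩ T
        I∩U⊆U∩T x∈ = let x∈I , x∈U = x∈p∩q⁻ I U x∈ in x∈p∩q⁺ (x∈U , N.indep⊆E i x∈I)

        -- `I ∩ U` is an independent subset of `U ∩ T`, so if nonempty it makes the rank positive.
        dichotomy : ∣ I ∩ U ∣ ≡ 0 ⊎ 0 < N.rank (U ∩ T)
        dichotomy with ∣ I ∩ U ∣ in eq
        ... | zero  = inj₁ refl
        ... | suc n = inj₂ (≤-trans (subst (0 <_) (sym eq) (s≤s z≤n))
                              (N.∣indep∣≤rank I∩U⊆U∩T (N.⊆-indep (p∩q⊆p I U) i)))

        I∩U⊆K : I ∩ U ⊆ K
        I∩U⊆K x∈ with dichotomy
        ... | inj₂ 0<      = U∩T⊆basis 0< (I∩U⊆U∩T x∈)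
        ... | inj₁ ∣I∩U∣≡0 = p∩q⊆p K (I ∩ U) (⊆∧∣≥∣⇒⊇ (p∩q⊆q K (I ∩ U))
                               (subst (_≤ ∣ K ∩ (I ∩ U) ∣) (sym ∣I∩U∣≡0) z≤n) x∈)

        I⊆P∪K : I ⊆ P ∪ K
        I⊆P∪K {x} x∈I with x ∈? U
        ... | yes x∈U = q⊆p∪q P K (I∩U⊆K (x∈p∩q⁺ (x∈I , x∈U)))
        ... | no  x∉U = p⊆p∪q K (I─U⊆P (x∈p∧x∉q⇒x∈p─q x∈I x∉U))

        S-part : M.Indep ((P ∪ K) ∩ S)
        S-part with dichotomy
        -- `I` misses `U`, so it lies in `P`, and the sizes force `P` into `I`, hence into `T`: only
        -- `K` contributes to the part in `S`.
        ... | inj₁ ∣I∩U∣≡0 = M.⊆-indep PK∩S⊆ k-indep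
          where
          P⊆I : P ⊆ I
          P⊆I = p─q⊆p I U ∘ ⊆∧∣≥∣⇒⊇ I─U⊆P (≤-trans ∣P∣≤ (≤-reflexive
                  (trans (∣∩∣+∣─∣ I U) (cong (_+ ∣ I ─ U ∣) ∣I∩U∣≡0))))

          PK∩S⊆ : (P ∪ K) ∩ S ⊆ K ∩ S
          PK∩S⊆ x∈ = let x∈PK , x∈S = x∈p∩q⁻ (P ∪ K) S x∈ in
            [ (λ x∈P → ⊥-elim (S∩T=∅ (_ , x∈p∩q⁺ (x∈S , N.indep⊆E i (P⊆I x∈P)))))
            , (λ x∈K → x∈p∩q⁺ (x∈K , x∈S)) ] (x∈p∪q⁻ P K x∈PK)
        -- `P` avoids `U`, so it contributes only coloops from `S ─ U`.
        ... | inj₂ 0< = M.⊆-indep PK∩S⊆ (basis∪S─U-indep 0<)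
          where
          PK∩S⊆ : (P ∪ K) ∩ S ⊆ (K ∩ S) ∪ (S ─ U)
          PK∩S⊆ x∈ = let x∈PK , x∈S = x∈p∩q⁻ (P ∪ K) S x∈ in
            [ (λ x∈P → q⊆p∪q (K ∩ S) (S ─ U)
                         (x∈p∧x∉q⇒x∈p─q x∈S (x∈p─q⇒x∉q (S ∪ T) U (P⊆ x∈P))))
            , (λ x∈K → p⊆p∪q (S ─ U) (x∈p∩q⁺ (x∈K , x∈S))) ] (x∈p∪q⁻ P K x∈PK)

    contraction-weakMap : L.rank U ≡ M.rank S → BijectiveWeakMap (L / U) N
    contraction-weakMap rankU≡ = record
      { φ              = φ
      ; preimage-indep = λ {I} i →
          let P⊆          = preimage⊆ f I
              K , K-basis = L.basis U
              -- Elements of `I` outside `U` belong to both ground sets, so the bijection fixes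
              -- them.
              I─U⊆P : I ─ U ⊆ preimage f I
              I─U⊆P x∈ =
                let x∈I = p─q⊆p I U x∈
                    x∈T = N.indep⊆E i x∈I
                in ∩⊆preimage f I fixes (N.indep⊆E i) (x∈p∩q⁺ (x∈I ,
                     x∈p∧x∉q⇒x∈p─q (q⊆p∪q S T x∈T) (x∈p─q⇒x∉q I U x∈)))
          in P⊆ , K , K-basis , ∪basis-indep rankU≡ K-basis i P⊆
               (∣preimage∣≤ f I (Bijection.injective φ)) I─U⊆P
      }
      where
      φ     = proj₁ (fixingBijection {F = T} ∣S∪T─U∣≡∣T∣)
      fixes = proj₂ (fixingBijection {F = T} ∣S∪T─U∣≡∣T∣)
      f     = Bijection.to φ

theorem7 : ∀ {k : ℕ} {S T : Subset k} (M : Matroid S) (N : Matroid T) (S∩T=∅ : Empty (S ∩ T)) →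
    let L = freeProduct M N S∩T=∅ in
    (U : Subset k) → U ⊆ S ∪ T → ∣ U ∣ ≡ ∣ S ∣ → rank L U ≡ rank M S →
    BijectiveWeakMap (L ↾ U) M × BijectiveWeakMap (L / U) N
theorem7 M N S∩T=∅ U U⊆ ∣U∣≡∣S∣ rankU≡ =
  restriction-weakMap U⊆ ∣U∣≡∣S∣ , contraction-weakMap U⊆ ∣U∣≡∣S∣ rankU≡
  where open FreeProduct M N S∩T=∅
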